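{- The four identities (J1) $x\wedge y\approx y\wedge x$, (J2) $x\wedge(y\wedge z)\approx(x\wedge y)\wedge z$, (J4) $x''\approx x$, (J5) $x'\approx (x\wedge y)'\wedge(x\wedge y')'$ form a 4-base for the variety $\mathbb{BA}$ of Boolean algebras (in the language $\langle\wedge,{}'\rangle$). In particular, the idempotent law $x\wedge x\approx x$ follows from (J1), (J2), (J4), (J5).
   Context: Algebras are of type $\langle \wedge, {}'\rangle$ with $\wedge$ binary and ${}'$ unary. The variety $\mathbb{BA}$ of Boolean algebras in this language consists of the algebras $\langle B,\wedge,{}'\rangle$ obtained from Boolean algebras by keeping only meet and complement (equivalently, the variety generated by the two-element Boolean algebra $\mathbf 2$ with meet and complement). A base for a variety is an independent set of identities (no identity in the set follows from the others) that defines the variety; an $n$-base is a base with exactly $n$ identities. -}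

module Defs where

open import Algebra.Core using (Op₁; Op₂)
open import Algebra.Definitions using (Congruent₁; Congruent₂)
open import Algebra.Lattice.Structures using (IsBooleanAlgebra)
open import Data.Nat.Base using (ℕ)
open import Data.Product.Base using (_×_; Σ-syntax)
open import Data.Vec.Base using (Vec; []; _∷_)
import Data.Vec.Membership.Propositional as VecMembership
open import Data.Vec.Relation.Unary.Unique.Propositional using (Unique)
open import Function.Bundles using (_⇔_)
open import Level using (Level; 0ℓ; suc; _⊔_)
open import Relation.Binary.Core using (Rel)
open import Relation.Binary.Structures using (IsEquivalence)
open import Relation.Nullary.Negation.Core using (¬_)
open import Relation.Unary using (Pred; _∈_; _∖_; ｛_｝)

private
  variable
    c ℓ p : Level

-- Since the language has no constants, the usual convention that algebras are
-- nonempty has to be imposed explicitly.  The inhabitant is not part of the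
-- structure: neither terms nor the class of Boolean algebras refer to it.
record Algebra c ℓ : Set (suc (c ⊔ ℓ)) where
  infix  4 _≈_
  infixl 7 _∧_
  infix  8 _′
  field
    Carrier       : Set c
    _≈_           : Rel Carrier ℓ
    _∧_           : Op₂ Carrier
    _′            : Op₁ Carrier
    isEquivalence : IsEquivalence _≈_
    ∧-cong        : Congruent₂ _≈_ _∧_
    ′-cong        : Congruent₁ _≈_ _′
    inhabitant    : Carrier

infixl 7 _∧_
infix  8 _′

data Term : Set where
  var : ℕ → Term
  _∧_ : Term → Term → Term
  _′  : Term → Term

infix 4 _≐_

record Identity : Set where
  constructor _≐_
  field
    lhs rhs : Term

Theory : Set₁
Theory = Pred Identity 0ℓ

module _ (A : Algebra c ℓ) where
  private module A = Algebra A

  ⟦_⟧ : Term → (ℕ → A.Carrier) → A.Carrier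
  ⟦ var i ⟧ ρ = ρ i
  ⟦ s ∧ t ⟧ ρ = ⟦ s ⟧ ρ A.∧ ⟦ t ⟧ ρ
  ⟦ t ′ ⟧   ρ = (⟦ t ⟧ ρ) A.′

  Satisfies : Identity → Set (c ⊔ ℓ)
  Satisfies (s ≐ t) = ∀ ρ → ⟦ s ⟧ ρ A.≈ ⟦ t ⟧ ρ

  IsModel : Theory → Set (c ⊔ ℓ)
  IsModel 𝓔 = ∀ e → e ∈ 𝓔 → Satisfies e

  -- The remaining operations are existentially quantified: A is what is left
  -- of a Boolean algebra when only meet and complement are kept.
  IsBooleanReduct : Set (c ⊔ ℓ)
  IsBooleanReduct =
    Σ[ ∨ ∈ Op₂ A.Carrier ] Σ[ ⊤ ∈ A.Carrier ] Σ[ ⊥ ∈ A.Carrier ]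
      IsBooleanAlgebra A._≈_ ∨ A._∧_ A._′ ⊤ ⊥

𝔹𝔸 : ∀ c ℓ → Pred (Algebra c ℓ) (c ⊔ ℓ)
𝔹𝔸 c ℓ = IsBooleanReduct

Follows : ∀ c ℓ → Theory → Identity → Set (suc (c ⊔ ℓ))
Follows c ℓ 𝓔 e = (A : Algebra c ℓ) → IsModel A 𝓔 → Satisfies A e

Independent : ∀ c ℓ → Theory → Set (suc (c ⊔ ℓ))
Independent c ℓ 𝓔 = ∀ e → e ∈ 𝓔 → ¬ Follows c ℓ (𝓔 ∖ ｛ e ｝) e

Defines : Pred (Algebra c ℓ) p → Theory → Set (suc (c ⊔ ℓ) ⊔ p)
Defines 𝓥 𝓔 = ∀ A → IsModel A 𝓔 ⇔ A ∈ 𝓥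

IsBase : Pred (Algebra c ℓ) p → Theory → Set (suc (c ⊔ ℓ) ⊔ p)
IsBase {c} {ℓ} 𝓥 𝓔 = Independent c ℓ 𝓔 × Defines 𝓥 𝓔

theory : ∀ {n} → Vec Identity n → Theory
theory es e = e VecMembership.∈ es

Is_-Base : ∀ n → Pred (Algebra c ℓ) p → Vec Identity n → Set (suc (c ⊔ ℓ) ⊔ p)
Is n -Base 𝓥 es = Unique es × IsBase 𝓥 (theory es)

private
  x y z : Term
  x = var 0
  y = var 1
  z = var 2

J1 J2 J4 J5 idempotence : Identity
J1 = x ∧ y ≐ y ∧ x
J2 = x ∧ (y ∧ z) ≐ (x ∧ y) ∧ z
J4 = x ′ ′ ≐ x
J5 = x ′ ≐ (x ∧ y) ′ ∧ (x ∧ y ′) ′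
idempotence = x ∧ x ≐ x

Js : Vec Identity 4
Js = J1 ∷ J2 ∷ J4 ∷ J5 ∷ []

{-# OPTIONS --safe #-}

-- Replacing x by x′ in (J5) and cancelling the double complement gives
-- Huntington's equation x ≈ (x′ ∧ y)′ ∧ (x′ ∧ y′)′.  Expanding x and x′ along y
-- shows that x ∧ x′ does not depend on x; calling it ⊥ and its complement ⊤,
-- the instances y = x of (J5) yield first that ⊤ is a unit and then
-- idempotence.  Elements are determined by their meets with x and x′, and
-- distributivity is checked on these two parts separately.
module Submission where

open import Defs hiding (_∧_; _′)
open import Algebra.Bundles using (CommutativeSemigroup)
open import Algebra.Core using (Op₁; Op₂)
open import Algebra.Lattice.Bundles using (BooleanAlgebra)
open import Algebra.Lattice.Structures using (IsBooleanAlgebra)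
import Algebra.Consequences.Setoid as Consequences
import Algebra.Lattice.Properties.BooleanAlgebra as BooleanAlgebraProperties
import Algebra.Properties.CommutativeSemigroup as CommutativeSemigroupProperties
open import Data.Bool.Base using (true; false)
open import Data.Fin.Base using (Fin)
open import Data.Fin.Patterns using (0F; 1F; 2F)
open import Data.Fin.Properties using (_≟_; all?)
open import Data.Nat.Base using (ℕ)
open import Data.Product.Base using (_×_; _,_)
open import Data.Sum.Base using (_⊎_; inj₁; inj₂)
open import Data.Vec.Base using (Vec)
open import Data.Vec.Relation.Unary.All as All using (All; []; _∷_)
open import Data.Vec.Relation.Unary.AllPairs using ([]; _∷_)
open import Data.Vec.Relation.Unary.Any using (here; there)
open import Data.Vec.Relation.Unary.Unique.Propositional using (Unique)
open import Function.Base using (const; id)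
open import Function.Bundles using (mk⇔)
open import Level using (Level; Lift; lift; lower)
open import Relation.Binary.Structures using (IsEquivalence)
open import Relation.Binary.PropositionalEquality as ≡ using (_≡_)
import Relation.Binary.Reasoning.Setoid as SetoidReasoning
open import Relation.Nullary.Decidable using (from-yes)
open import Relation.Nullary.Negation using (¬_; contradiction)
open import Relation.Unary using (_∖_; ｛_｝)

private
  variable
    c ℓ : Level

-- All indices from 2 on share the last value, so an identity in fewer than three variables is
-- instantiated by repeating an argument.
assign : {X : Set c} → X → X → X → ℕ → X
assign x y z 0 = x
assign x y z 1 = y
assign x y z _ = z

-- Meet and complement in a model of the four identities

module JsModel (A : Algebra c ℓ) (A⊨Js : IsModel A (theory Js)) where
  open Algebra A

  ∧-comm : ∀ x y → x ∧ y ≈ y ∧ x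
  ∧-comm x y = A⊨Js J1 (here ≡.refl) (assign x y y)

  ∧-assoc : ∀ x y z → (x ∧ y) ∧ z ≈ x ∧ (y ∧ z)
  ∧-assoc x y z =
    IsEquivalence.sym isEquivalence (A⊨Js J2 (there (here ≡.refl)) (assign x y z))

  ′-involutive : ∀ x → x ′ ′ ≈ x
  ′-involutive x = A⊨Js J4 (there (there (here ≡.refl))) (assign x x x)

  ′-split : ∀ x y → x ′ ≈ (x ∧ y) ′ ∧ (x ∧ y ′) ′
  ′-split x y = A⊨Js J5 (there (there (there (here ≡.refl)))) (assign x y y)

  commutativeSemigroup : CommutativeSemigroup c ℓ
  commutativeSemigroup = record
    { isCommutativeSemigroup = record
      { isSemigroup = record
        { isMagma = record { isEquivalence = isEquivalence ; ∙-cong = ∧-cong }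
        ; assoc   = ∧-assoc
        }
      ; comm = ∧-comm
      }
    }

  open CommutativeSemigroup commutativeSemigroup
    using (setoid; refl; sym; trans)
    renaming (∙-congˡ to ∧-congˡ; ∙-congʳ to ∧-congʳ)
  open CommutativeSemigroupProperties commutativeSemigroup
    using (interchange; xy∙z≈xz∙y; x∙yz≈xz∙y)
  open SetoidReasoning setoid

  huntington : ∀ x y → x ≈ (x ′ ∧ y) ′ ∧ (x ′ ∧ y ′) ′
  huntington x y = trans (sym (′-involutive x)) (′-split (x ′) y)

  ′-injective : ∀ {x y} → x ′ ≈ y ′ → x ≈ y
  ′-injective {x} {y} x′≈y′ = begin
    x      ≈⟨ ′-involutive x ⟨
    x ′ ′  ≈⟨ ′-cong x′≈y′ ⟩
    y ′ ′  ≈⟨ ′-involutive y ⟩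
    y      ∎

  -- The expansion is the meet of the complements of all four products of `x` or `x ′` with `y` or
  -- `y ′`. Up to commutativity and associativity this is symmetric in `x` and `y`.
  x∧x′≈y∧y′ : ∀ x y → x ∧ x ′ ≈ y ∧ y ′
  x∧x′≈y∧y′ x y = begin
    x ∧ x ′
      ≈⟨ ∧-cong (huntington x y) (′-split x y) ⟩
    ((x ′ ∧ y) ′ ∧ (x ′ ∧ y ′) ′) ∧ ((x ∧ y) ′ ∧ (x ∧ y ′) ′)
      ≈⟨ interchange _ _ _ _ ⟩
    ((x ′ ∧ y) ′ ∧ (x ∧ y) ′) ∧ ((x ′ ∧ y ′) ′ ∧ (x ∧ y ′) ′)
      ≈⟨ ∧-comm _ _ ⟩
    ((x ′ ∧ y ′) ′ ∧ (x ∧ y ′) ′) ∧ ((x ′ ∧ y) ′ ∧ (x ∧ y) ′)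
      ≈⟨ ∧-cong (∧-comm _ _) (∧-comm _ _) ⟩
    ((x ∧ y ′) ′ ∧ (x ′ ∧ y ′) ′) ∧ ((x ∧ y) ′ ∧ (x ′ ∧ y) ′)
      ≈⟨ ∧-cong (∧-cong (′-cong (∧-comm _ _)) (′-cong (∧-comm _ _)))
                (∧-cong (′-cong (∧-comm _ _)) (′-cong (∧-comm _ _))) ⟩
    ((y ′ ∧ x) ′ ∧ (y ′ ∧ x ′) ′) ∧ ((y ∧ x) ′ ∧ (y ∧ x ′) ′)
      ≈⟨ ∧-cong (huntington y x) (′-split y x) ⟨
    y ∧ y ′
      ∎

  -- The language has no constants, so an arbitrary element has to supply them; by `x∧x′≈y∧y′` the
  -- choice does not matter.
  ⊥ ⊤ : Carrier
  ⊥ = inhabitant ∧ inhabitant ′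
  ⊤ = ⊥ ′

  ∧-complementʳ : ∀ x → x ∧ x ′ ≈ ⊥
  ∧-complementʳ x = x∧x′≈y∧y′ x inhabitant

  x′≈[x∧x]′∧⊤ : ∀ x → x ′ ≈ (x ∧ x) ′ ∧ ⊤
  x′≈[x∧x]′∧⊤ x = trans (′-split x x) (∧-congˡ (′-cong (∧-complementʳ x)))

  -- As `⊤` is `⊥ ′`, the meet of `⊥` and `⊤` is `⊥`. Expanding this `⊤` shows that `⊥` absorbs
  -- `(⊥ ∧ ⊥) ′`, which turns `⊥ ∧ ⊥` into the meet of an element with its own complement.
  ⊥∧⊥≈⊥ : ⊥ ∧ ⊥ ≈ ⊥
  ⊥∧⊥≈⊥ = begin
    ⊥ ∧ ⊥                      ≈⟨ ∧-congˡ ⊥≈⊥∧[⊥∧⊥]′ ⟩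
    ⊥ ∧ (⊥ ∧ (⊥ ∧ ⊥) ′)        ≈⟨ ∧-assoc _ _ _ ⟨
    (⊥ ∧ ⊥) ∧ (⊥ ∧ ⊥) ′        ≈⟨ ∧-complementʳ (⊥ ∧ ⊥) ⟩
    ⊥                          ∎
    where
    ⊥≈⊥∧[⊥∧⊥]′ : ⊥ ≈ ⊥ ∧ (⊥ ∧ ⊥) ′
    ⊥≈⊥∧[⊥∧⊥]′ = begin
      ⊥                        ≈⟨ ∧-complementʳ ⊥ ⟨
      ⊥ ∧ ⊤                    ≈⟨ ∧-congˡ (x′≈[x∧x]′∧⊤ ⊥) ⟩
      ⊥ ∧ ((⊥ ∧ ⊥) ′ ∧ ⊤)      ≈⟨ x∙yz≈xz∙y _ _ _ ⟩
      (⊥ ∧ ⊤) ∧ (⊥ ∧ ⊥) ′      ≈⟨ ∧-congʳ (∧-complementʳ ⊥) ⟩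
      ⊥ ∧ (⊥ ∧ ⊥) ′            ∎

  ⊤∧⊤≈⊤ : ⊤ ∧ ⊤ ≈ ⊤
  ⊤∧⊤≈⊤ = begin
    ⊤ ∧ ⊤            ≈⟨ ∧-congʳ (′-cong ⊥∧⊥≈⊥) ⟨
    (⊥ ∧ ⊥) ′ ∧ ⊤    ≈⟨ x′≈[x∧x]′∧⊤ ⊥ ⟨
    ⊤                ∎

  -- Every element is a complement, hence already has a factor `⊤`; a second one is swallowed
  -- because `⊤` is idempotent.
  ∧-identityʳ : ∀ x → x ∧ ⊤ ≈ x
  ∧-identityʳ x = begin
    x ∧ ⊤                          ≈⟨ ∧-congʳ x≈[x′∧x′]′∧⊤ ⟩
    ((x ′ ∧ x ′) ′ ∧ ⊤) ∧ ⊤        ≈⟨ ∧-assoc _ _ _ ⟩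
    (x ′ ∧ x ′) ′ ∧ (⊤ ∧ ⊤)        ≈⟨ ∧-congˡ ⊤∧⊤≈⊤ ⟩
    (x ′ ∧ x ′) ′ ∧ ⊤              ≈⟨ x≈[x′∧x′]′∧⊤ ⟨
    x                              ∎
    where
    x≈[x′∧x′]′∧⊤ : x ≈ (x ′ ∧ x ′) ′ ∧ ⊤
    x≈[x′∧x′]′∧⊤ = trans (sym (′-involutive x)) (x′≈[x∧x]′∧⊤ (x ′))

  ∧-idem : ∀ x → x ∧ x ≈ x
  ∧-idem x = ′-injective (begin
    (x ∧ x) ′        ≈⟨ ∧-identityʳ _ ⟨
    (x ∧ x) ′ ∧ ⊤    ≈⟨ x′≈[x∧x]′∧⊤ x ⟨
    x ′              ∎)

  -- By (J5) the second factor already occurs in `x ′`, and idempotence removes the repetition. This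
  -- is order reversal applied to `x ∧ y` lying below `x`; both absorption laws come from it.
  x′∧[x∧y]′≈x′ : ∀ x y → x ′ ∧ (x ∧ y) ′ ≈ x ′
  x′∧[x∧y]′≈x′ x y = begin
    x ′ ∧ (x ∧ y) ′                            ≈⟨ ∧-congʳ (′-split x y) ⟩
    ((x ∧ y) ′ ∧ (x ∧ y ′) ′) ∧ (x ∧ y) ′      ≈⟨ xy∙z≈xz∙y _ _ _ ⟩
    ((x ∧ y) ′ ∧ (x ∧ y) ′) ∧ (x ∧ y ′) ′      ≈⟨ ∧-congʳ (∧-idem _) ⟩
    (x ∧ y) ′ ∧ (x ∧ y ′) ′                    ≈⟨ ′-split x y ⟨
    x ′                                        ∎

  -- (J5) recovers `x ′` from the two parts `x ∧ z` and `x ∧ z ′`, and complementation is injective.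
  separation : ∀ {x y} z → x ∧ z ≈ y ∧ z → x ∧ z ′ ≈ y ∧ z ′ → x ≈ y
  separation {x} {y} z p q = ′-injective (begin
    x ′                        ≈⟨ ′-split x z ⟩
    (x ∧ z) ′ ∧ (x ∧ z ′) ′    ≈⟨ ∧-cong (′-cong p) (′-cong q) ⟩
    (y ∧ z) ′ ∧ (y ∧ z ′) ′    ≈⟨ ′-split y z ⟨
    y ′                        ∎)

  -- When the part of `x` inside `y` is `⊥`, the first factor in (J5) becomes the unit `⊤`.
  disjoint⇒≤′ : ∀ {x y} → x ∧ y ≈ ⊥ → x ≈ x ∧ y ′
  disjoint⇒≤′ {x} {y} x∧y≈⊥ = ′-injective (begin
    x ′                        ≈⟨ ′-split x y ⟩
    (x ∧ y) ′ ∧ (x ∧ y ′) ′    ≈⟨ ∧-congʳ (′-cong x∧y≈⊥) ⟩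
    ⊤ ∧ (x ∧ y ′) ′            ≈⟨ ∧-comm _ _ ⟩
    (x ∧ y ′) ′ ∧ ⊤            ≈⟨ ∧-identityʳ _ ⟩
    (x ∧ y ′) ′                ∎)

  -- The left side meets `y` in `(x ∧ y) ∧ (x ∧ y) ′`, which is `⊥`, so it lies below `y ′`. Once
  -- `y ′` is a factor, it absorbs `(x ∧ y) ′` by order reversal.
  x∧[x∧y]′≈x∧y′ : ∀ x y → x ∧ (x ∧ y) ′ ≈ x ∧ y ′
  x∧[x∧y]′≈x∧y′ x y = begin
    x ∧ (x ∧ y) ′              ≈⟨ disjoint⇒≤′ disjoint ⟩
    (x ∧ (x ∧ y) ′) ∧ y ′      ≈⟨ x∙yz≈xz∙y _ _ _ ⟨
    x ∧ (y ′ ∧ (x ∧ y) ′)      ≈⟨ ∧-congˡ (∧-congˡ (′-cong (∧-comm x y))) ⟩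
    x ∧ (y ′ ∧ (y ∧ x) ′)      ≈⟨ ∧-congˡ (x′∧[x∧y]′≈x′ y x) ⟩
    x ∧ y ′                    ∎
    where
    disjoint : (x ∧ (x ∧ y) ′) ∧ y ≈ ⊥
    disjoint = trans (xy∙z≈xz∙y _ _ _) (∧-complementʳ (x ∧ y))

  -- The De Morgan join and the Boolean algebra axioms

  infixl 6 _∨_
  _∨_ : Op₂ Carrier
  x ∨ y = (x ′ ∧ y ′) ′

  ∨-cong : ∀ {x y u v} → x ≈ y → u ≈ v → x ∨ u ≈ y ∨ v
  ∨-cong x≈y u≈v = ′-cong (∧-cong (′-cong x≈y) (′-cong u≈v))

  ∨-comm : ∀ x y → x ∨ y ≈ y ∨ x
  ∨-comm x y = ′-cong (∧-comm (x ′) (y ′))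

  ∨-assoc : ∀ x y z → (x ∨ y) ∨ z ≈ x ∨ (y ∨ z)
  ∨-assoc x y z = ′-cong (begin
    (x ′ ∧ y ′) ′ ′ ∧ z ′    ≈⟨ ∧-congʳ (′-involutive _) ⟩
    (x ′ ∧ y ′) ∧ z ′        ≈⟨ ∧-assoc _ _ _ ⟩
    x ′ ∧ (y ′ ∧ z ′)        ≈⟨ ∧-congˡ (′-involutive _) ⟨
    x ′ ∧ (y ′ ∧ z ′) ′ ′    ∎)

  ∨-absorbs-∧ : ∀ x y → x ∨ (x ∧ y) ≈ x
  ∨-absorbs-∧ x y = trans (′-cong (x′∧[x∧y]′≈x′ x y)) (′-involutive x)

  ∧-absorbs-∨ : ∀ x y → x ∧ (x ∨ y) ≈ x
  ∧-absorbs-∨ x y = begin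
    x ∧ (x ∨ y)        ≈⟨ ∧-congʳ (′-involutive x) ⟨
    x ′ ′ ∧ (x ∨ y)    ≈⟨ x′∧[x∧y]′≈x′ (x ′) (y ′) ⟩
    x ′ ′              ≈⟨ ′-involutive x ⟩
    x                  ∎

  -- The complements of both sides are compared along `x`. Inside `x` both reduce to the meet of
  -- `x`, `y ′` and `z ′`; inside `x ′` both are all of `x ′`, since every complement involved lies
  -- above it.
  ∧-distribˡ-∨ : ∀ x y z → x ∧ (y ∨ z) ≈ (x ∧ y) ∨ (x ∧ z)
  ∧-distribˡ-∨ x y z = ′-injective (begin
    (x ∧ (y ∨ z)) ′              ≈⟨ separation x ∧x-agree ∧x′-agree ⟩
    (x ∧ y) ′ ∧ (x ∧ z) ′        ≈⟨ ′-involutive _ ⟨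
    ((x ∧ y) ∨ (x ∧ z)) ′        ∎)
    where
    ∧x-agree : (x ∧ (y ∨ z)) ′ ∧ x ≈ ((x ∧ y) ′ ∧ (x ∧ z) ′) ∧ x
    ∧x-agree = begin
      (x ∧ (y ∨ z)) ′ ∧ x              ≈⟨ ∧-comm _ _ ⟩
      x ∧ (x ∧ (y ∨ z)) ′              ≈⟨ x∧[x∧y]′≈x∧y′ x (y ∨ z) ⟩
      x ∧ (y ∨ z) ′                    ≈⟨ ∧-congˡ (′-involutive _) ⟩
      x ∧ (y ′ ∧ z ′)                  ≈⟨ x∙yz≈xz∙y _ _ _ ⟩
      (x ∧ z ′) ∧ y ′                  ≈⟨ ∧-congʳ (x∧[x∧y]′≈x∧y′ x z) ⟨
      (x ∧ (x ∧ z) ′) ∧ y ′            ≈⟨ xy∙z≈xz∙y _ _ _ ⟩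
      (x ∧ y ′) ∧ (x ∧ z) ′            ≈⟨ ∧-congʳ (x∧[x∧y]′≈x∧y′ x y) ⟨
      (x ∧ (x ∧ y) ′) ∧ (x ∧ z) ′      ≈⟨ ∧-assoc _ _ _ ⟩
      x ∧ ((x ∧ y) ′ ∧ (x ∧ z) ′)      ≈⟨ ∧-comm _ _ ⟩
      ((x ∧ y) ′ ∧ (x ∧ z) ′) ∧ x      ∎

    ∧x′-agree : (x ∧ (y ∨ z)) ′ ∧ x ′ ≈ ((x ∧ y) ′ ∧ (x ∧ z) ′) ∧ x ′
    ∧x′-agree = begin
      (x ∧ (y ∨ z)) ′ ∧ x ′            ≈⟨ ∧-comm _ _ ⟩
      x ′ ∧ (x ∧ (y ∨ z)) ′            ≈⟨ x′∧[x∧y]′≈x′ x (y ∨ z) ⟩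
      x ′                              ≈⟨ x′∧[x∧y]′≈x′ x z ⟨
      x ′ ∧ (x ∧ z) ′                  ≈⟨ ∧-congʳ (x′∧[x∧y]′≈x′ x y) ⟨
      (x ′ ∧ (x ∧ y) ′) ∧ (x ∧ z) ′    ≈⟨ ∧-assoc _ _ _ ⟩
      x ′ ∧ ((x ∧ y) ′ ∧ (x ∧ z) ′)    ≈⟨ ∧-comm _ _ ⟩
      ((x ∧ y) ′ ∧ (x ∧ z) ′) ∧ x ′    ∎

  ∨-complementʳ : ∀ x → x ∨ x ′ ≈ ⊤
  ∨-complementʳ x = ′-cong (∧-complementʳ (x ′))

  isBooleanAlgebra : IsBooleanAlgebra _≈_ _∨_ _∧_ _′ ⊤ ⊥
  isBooleanAlgebra = record
    { isDistributiveLattice = record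
      { isLattice = record
        { isEquivalence = isEquivalence
        ; ∨-comm        = ∨-comm
        ; ∨-assoc       = ∨-assoc
        ; ∨-cong        = ∨-cong
        ; ∧-comm        = ∧-comm
        ; ∧-assoc       = ∧-assoc
        ; ∧-cong        = ∧-cong
        ; absorptive    = ∨-absorbs-∧ , ∧-absorbs-∨
        }
      -- In a lattice, absorption turns one distributive law into its dual.
      ; ∨-distrib-∧ = comm∧distrˡ⇒distr ∧-cong ∨-comm
          (distrib∧absorbs⇒distribˡ ∨-cong ∨-assoc ∧-comm
            ∨-absorbs-∧ ∧-absorbs-∨ ∧-distrib-∨)
      ; ∧-distrib-∨ = ∧-distrib-∨
      }
    ; ∨-complement = comm∧invʳ⇒inv ∨-comm ∨-complementʳ
    ; ∧-complement = comm∧invʳ⇒inv ∧-comm ∧-complementʳ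
    ; ¬-cong       = ′-cong
    }
    where
    open Consequences setoid
    ∧-distrib-∨ = comm∧distrˡ⇒distr ∨-cong ∧-comm ∧-distribˡ-∨

  isBooleanReduct : IsBooleanReduct A
  isBooleanReduct = _∨_ , ⊤ , ⊥ , isBooleanAlgebra

-- Boolean algebras satisfy the four identities

IsBooleanReduct⇒IsModel : (A : Algebra c ℓ) → IsBooleanReduct A → IsModel A (theory Js)
IsBooleanReduct⇒IsModel A (_ , _ , _ , isBA) e e∈Js = All.lookup allJs e∈Js
  where
  B : BooleanAlgebra _ _
  B = record { isBooleanAlgebra = isBA }
  open BooleanAlgebra B renaming (¬_ to infix 8 _′; ¬-cong to ′-cong)
  open BooleanAlgebraProperties B using (¬-involutive; deMorgan₂; ∧-identityʳ)
  open SetoidReasoning setoid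

  -- Cut `x` along `y ∨ y ′`, then complement the resulting join.
  ′-split : ∀ x y → x ′ ≈ (x ∧ y) ′ ∧ (x ∧ y ′) ′
  ′-split x y = begin
    x ′                            ≈⟨ ′-cong (∧-identityʳ x) ⟨
    (x ∧ ⊤) ′                      ≈⟨ ′-cong (∧-congˡ (∨-complementʳ y)) ⟨
    (x ∧ (y ∨ y ′)) ′              ≈⟨ ′-cong (∧-distribˡ-∨ x y (y ′)) ⟩
    ((x ∧ y) ∨ (x ∧ y ′)) ′        ≈⟨ deMorgan₂ (x ∧ y) (x ∧ y ′) ⟩
    (x ∧ y) ′ ∧ (x ∧ y ′) ′        ∎

  allJs : All (Satisfies A) Js
  allJs = (λ ρ → ∧-comm (ρ 0) (ρ 1))
        ∷ (λ ρ → sym (∧-assoc (ρ 0) (ρ 1) (ρ 2)))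
        ∷ (λ ρ → ¬-involutive (ρ 0))
        ∷ (λ ρ → ′-split (ρ 0) (ρ 1))
        ∷ []

-- Distinctness and independence of the identities

Js-unique : Unique Js
Js-unique = ((λ ()) ∷ (λ ()) ∷ (λ ()) ∷ [])
          ∷ ((λ ()) ∷ (λ ()) ∷ [])
          ∷ ((λ ()) ∷ [])
          ∷ []
          ∷ []

-- Independence is claimed at all levels, while the countermodels live on small finite sets; hence
-- the lifting of carrier and equality.
discrete : {X : Set} → X → Op₂ X → Op₁ X → Algebra c ℓ
discrete {c} {ℓ} {X} x _∙_ _⁻ = record
  { Carrier       = Lift c X
  ; _≈_           = λ a b → Lift ℓ (lower a ≡ lower b)
  ; _∧_           = λ a b → lift (lower a ∙ lower b)
  ; _′            = λ a → lift (lower a ⁻)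
  ; isEquivalence = record
    { refl  = lift ≡.refl
    ; sym   = λ p → lift (≡.sym (lower p))
    ; trans = λ p q → lift (≡.trans (lower p) (lower q))
    }
  ; ∧-cong        = λ p q → lift (≡.cong₂ _∙_ (lower p) (lower q))
  ; ′-cong        = λ p → lift (≡.cong _⁻ (lower p))
  ; inhabitant    = lift x
  }

-- A single list runs over the whole of `es`: `inj₁` marks the omitted identity, which membership in
-- the difference rules out, and `inj₂` carries a verification.
¬Follows-by : ∀ {n} {es : Vec Identity n} {s t} (A : Algebra c ℓ) →
              All (λ f → (s ≐ t) ≡ f ⊎ Satisfies A f) es →
              ∀ ρ → ¬ Algebra._≈_ A (⟦_⟧ A s ρ) (⟦_⟧ A t ρ) →
              ¬ Follows c ℓ (theory es ∖ ｛ s ≐ t ｝) (s ≐ t)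
¬Follows-by {es = es} {s} {t} A allBut ρ s≉t follows = s≉t (follows A A⊨ ρ)
  where
  A⊨ : IsModel A (theory es ∖ ｛ s ≐ t ｝)
  A⊨ f (f∈es , s≐t≢f) with All.lookup allBut f∈es
  ... | inj₁ s≐t≡f = contradiction s≐t≡f s≐t≢f
  ... | inj₂ A⊨f   = A⊨f

-- Not associative: 1F ⊓ (1F ⊓ 2F) = 1F while (1F ⊓ 1F) ⊓ 2F = 0F.
_⊓_ : Op₂ (Fin 3)
0F ⊓ y  = y
1F ⊓ 2F = 0F
1F ⊓ _  = 1F
2F ⊓ 1F = 0F
2F ⊓ _  = 2F

-- With `_⊓_` this is the four-element Boolean algebra with its bottom merged into its top: `0F` is
-- the unit, is its own complement, and is the meet of the complementary atoms `1F` and `2F`.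
swap₁₂ : Op₁ (Fin 3)
swap₁₂ 0F = 0F
swap₁₂ 1F = 2F
swap₁₂ 2F = 1F

⊓-comm : ∀ x y → x ⊓ y ≡ y ⊓ x
⊓-comm = from-yes (all? λ x → all? λ y → x ⊓ y ≟ y ⊓ x)

swap₁₂-involutive : ∀ x → swap₁₂ (swap₁₂ x) ≡ x
swap₁₂-involutive = from-yes (all? λ x → swap₁₂ (swap₁₂ x) ≟ x)

swap₁₂-split : ∀ x y → swap₁₂ x ≡ swap₁₂ (x ⊓ y) ⊓ swap₁₂ (x ⊓ swap₁₂ y)
swap₁₂-split = from-yes (all? λ x → all? λ y →
  swap₁₂ x ≟ swap₁₂ (x ⊓ y) ⊓ swap₁₂ (x ⊓ swap₁₂ y))

Js-independent : Independent c ℓ (theory Js)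
Js-independent {c} {ℓ} e e∈Js = All.lookup independent e∈Js
  where
  independent : All (λ e → ¬ Follows c ℓ (theory Js ∖ ｛ e ｝) e) Js
  independent
    -- Under left projection with identity complement, each side of the other three identities
    -- evaluates to its leftmost variable `x`.
    = ¬Follows-by (discrete true const id)
        ( inj₁ ≡.refl
        ∷ inj₂ (λ ρ → lift ≡.refl)
        ∷ inj₂ (λ ρ → lift ≡.refl)
        ∷ inj₂ (λ ρ → lift ≡.refl)
        ∷ [])
        (assign (lift true) (lift false) (lift false)) (λ ())
    ∷ ¬Follows-by (discrete 0F _⊓_ swap₁₂)
        ( inj₂ (λ ρ → lift (⊓-comm (lower (ρ 0)) (lower (ρ 1))))
        ∷ inj₁ ≡.refl
        ∷ inj₂ (λ ρ → lift (swap₁₂-involutive (lower (ρ 0))))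
        ∷ inj₂ (λ ρ → lift (swap₁₂-split (lower (ρ 0)) (lower (ρ 1))))
        ∷ [])
        (assign (lift 1F) (lift 1F) (lift 2F)) (λ ())
    -- Every compound term is `true` here, and only (J4) has a bare variable as a side.
    ∷ ¬Follows-by (discrete true (λ _ _ → true) (const true))
        ( inj₂ (λ ρ → lift ≡.refl)
        ∷ inj₂ (λ ρ → lift ≡.refl)
        ∷ inj₁ ≡.refl
        ∷ inj₂ (λ ρ → lift ≡.refl)
        ∷ [])
        (const (lift false)) (λ ())
    -- With constant meet and identity complement, (J5) would make every element `true`.
    ∷ ¬Follows-by (discrete true (λ _ _ → true) id)
        ( inj₂ (λ ρ → lift ≡.refl)
        ∷ inj₂ (λ ρ → lift ≡.refl)
        ∷ inj₂ (λ ρ → lift ≡.refl)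
        ∷ inj₁ ≡.refl
        ∷ [])
        (const (lift false)) (λ ())
    ∷ []

theorem2p2 : (c ℓ : Level) → Is 4 -Base (𝔹𝔸 c ℓ) Js × Follows c ℓ (theory Js) idempotence
theorem2p2 c ℓ =
  ( Js-unique
  , Js-independent
  , λ A → mk⇔ (JsModel.isBooleanReduct A) (IsBooleanReduct⇒IsModel A)
  ) , λ A A⊨Js ρ → JsModel.∧-idem A A⊨Js (ρ 0)
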